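{- Let $t$ be a positive integer and let $G$ be a minimal counterexample to the following conjecture: every graph on $4t-1$ vertices with independence number $2$ satisfies $\mathrm{cm}(G)\ge t$. That is, $G$ has $4t-1$ vertices, $\alpha(G)=2$ and $\mathrm{cm}(G)\le t-1$, and the conjecture holds for every positive integer $t'<t$. Then for any disjoint subsets $S_1,S_2\subseteq V(G)$ (either of which may be empty) such that $G[S_1]$ and $G[S_2]$ are cliques and $S_1$ is anti-complete to $S_2$, we have $|S_1|+|S_2|\le t-4$.
   Context: All graphs are finite and simple. $\alpha(G)$ is the independence number. A matching $M$ in $G$ is connected if for every two edges of $M$ there is an edge of $G$ joining an endpoint of one to an endpoint of the other; $\mathrm{cm}(G)$ is the maximum size of a connected matching in $G$. Disjoint vertex sets $A,B$ are anti-complete if there is no edge between $A$ and $B$. $G[S]$ denotes the subgraph induced by $S$. -}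

module Defs where

open import Data.Fin using (Fin)
open import Data.Fin.Properties using (_≟_; any?; all?; injective⇒≤)
open import Data.Fin.Subset using (Subset; _∈_; ⊥; ∣_∣)
open import Data.Fin.Subset.Properties using (_∈?_; ∉⊥; ∣⊥∣≡0; ∣p∣≤n; anySubset?)
open import Data.Nat using (ℕ; zero; suc; _*_; _∸_; _≤_; _<_; z≤n; s≤s⁻¹)
open import Data.Nat.Properties using (≤∧≢⇒<) renaming (_≟_ to _≟ℕ_)
open import Data.Product using (_×_; _,_; proj₁; proj₂; ∃; uncurry)
open import Data.Sum using (_⊎_)
open import Data.Vec using (Vec; []; _∷_)
open import Data.Vec.Relation.Unary.All using (All; [])
  renaming (all? to allVec?)
open import Data.Vec.Relation.Unary.AllPairs using (AllPairs; []; allPairs?)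
  renaming (map to mapAllPairs)
open import Data.Vec.Relation.Unary.AllPairs.Properties using (map⁺)
open import Data.Vec.Relation.Unary.Unique.Propositional.Properties using (lookup-injective)
open import Level using (0ℓ)
open import Relation.Binary using (Rel; Symmetric; Irreflexive)
  renaming (Decidable to Decidable₂)
open import Relation.Binary.PropositionalEquality using (_≡_; _≢_; refl; subst)
open import Relation.Nullary using (¬_; Dec; yes; no; contradiction)
open import Relation.Nullary.Decidable using (map′; ¬?; _×-dec_; _⊎-dec_; _→-dec_)
open import Relation.Unary using (Decidable)

------------------------------------------------------------------------
-- The maximum of a decidable set of natural numbers

IsMaximum : (ℕ → Set) → ℕ → Set
IsMaximum P m = P m × (∀ k → P k → k ≤ m)

maximum : {P : ℕ → Set} → Decidable P → P 0 →
          ∀ b → (∀ k → P k → k ≤ b) → ∃ (IsMaximum P)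
maximum P? p₀ zero    P≤b = 0 , p₀ , P≤b
maximum {P} P? p₀ (suc b) P≤b with P? (suc b)
... | yes p = suc b , p , P≤b
... | no ¬p = maximum P? p₀ b λ k pk →
  s≤s⁻¹ (≤∧≢⇒< (P≤b k pk) λ k≡1+b → ¬p (subst P k≡1+b pk))

------------------------------------------------------------------------
-- Graphs

-- A finite simple graph on n vertices.  Adjacency is decidable, as is
-- implicit for finite graphs classically.
record Graph (n : ℕ) : Set₁ where
  field
    Adj     : Rel (Fin n) 0ℓ
    adj?    : Decidable₂ Adj
    symm    : Symmetric Adj
    irrefl  : Irreflexive _≡_ Adj

open Graph public

module _ {n : ℕ} where

  Disjoint : Subset n → Subset n → Set
  Disjoint S T = ∀ x → x ∈ S → ¬ (x ∈ T)

  IsClique : Graph n → Subset n → Set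
  IsClique G S = ∀ x y → x ∈ S → y ∈ S → x ≢ y → Adj G x y

  AntiComplete : Graph n → Subset n → Subset n → Set
  AntiComplete G S T = ∀ x y → x ∈ S → y ∈ T → ¬ Adj G x y

------------------------------------------------------------------------
-- Independence number

  IsIndependent : Graph n → Subset n → Set
  IsIndependent G S = ∀ x y → x ∈ S → y ∈ S → ¬ Adj G x y

  HasIndependentSet : Graph n → ℕ → Set
  HasIndependentSet G k = ∃ λ (S : Subset n) → IsIndependent G S × ∣ S ∣ ≡ k

  isIndependent? : (G : Graph n) → Decidable (IsIndependent G)
  isIndependent? G S = all? λ x → all? λ y →
    (x ∈? S) →-dec ((y ∈? S) →-dec ¬? (adj? G x y))

  α-maximum : (G : Graph n) → ∃ (IsMaximum (HasIndependentSet G))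
  α-maximum G = maximum
    (λ k → anySubset? λ S → isIndependent? G S ×-dec (∣ S ∣ ≟ℕ k))
    (⊥ , (λ _ _ x∈⊥ → contradiction x∈⊥ ∉⊥) , ∣⊥∣≡0 n)
    n
    λ { _ (S , _ , refl) → ∣p∣≤n S }

  α : Graph n → ℕ
  α G = proj₁ (α-maximum G)

------------------------------------------------------------------------
-- Connected matchings

  VertexDisjoint : Rel (Fin n × Fin n) 0ℓ
  VertexDisjoint (u , v) (x , y) = u ≢ x × u ≢ y × v ≢ x × v ≢ y

  Joined : Graph n → Rel (Fin n × Fin n) 0ℓ
  Joined G (u , v) (x , y) = Adj G u x ⊎ Adj G u y ⊎ Adj G v x ⊎ Adj G v y

  -- A matching of size k is given by listing its edges, in any order and
  -- each in either orientation; disjointness makes the edges distinct.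
  IsMatching : Graph n → {k : ℕ} → Vec (Fin n × Fin n) k → Set
  IsMatching G M = All (uncurry (Adj G)) M × AllPairs VertexDisjoint M

  IsConnectedMatching : Graph n → {k : ℕ} → Vec (Fin n × Fin n) k → Set
  IsConnectedMatching G M = IsMatching G M × AllPairs (Joined G) M

  HasConnectedMatching : Graph n → ℕ → Set
  HasConnectedMatching G k =
    ∃ λ (M : Vec (Fin n × Fin n) k) → IsConnectedMatching G M

  isConnectedMatching? : (G : Graph n) {k : ℕ} → Decidable (IsConnectedMatching G {k})
  isConnectedMatching? G M =
    (allVec? (λ (u , v) → adj? G u v) M ×-dec allPairs? disjoint? M)
      ×-dec allPairs? joined? M
    where
    disjoint? : Decidable₂ VertexDisjoint
    disjoint? (u , v) (x , y) =
      ¬? (u ≟ x) ×-dec ¬? (u ≟ y) ×-dec ¬? (v ≟ x) ×-dec ¬? (v ≟ y)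

    joined? : Decidable₂ (Joined G)
    joined? (u , v) (x , y) =
      adj? G u x ⊎-dec adj? G u y ⊎-dec adj? G v x ⊎-dec adj? G v y

  anyVec? : ∀ k {P : Vec (Fin n × Fin n) k → Set} → Decidable P → Dec (∃ P)
  anyVec? zero    P? = map′ ([] ,_) (λ { ([] , p) → p }) (P? [])
  anyVec? (suc k) P? = map′
    (λ { (u , v , M , p) → (u , v) ∷ M , p })
    (λ { ((u , v) ∷ M , p) → u , v , M , p })
    (any? λ u → any? λ v → anyVec? k λ M → P? ((u , v) ∷ M))

  matching-size≤n : (G : Graph n) {k : ℕ} (M : Vec (Fin n × Fin n) k) →
                    IsMatching G M → k ≤ n
  matching-size≤n G M (_ , disj) =
    injective⇒≤ (lookup-injective (map⁺ (mapAllPairs proj₁ disj)) _ _)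

  cm-maximum : (G : Graph n) → ∃ (IsMaximum (HasConnectedMatching G))
  cm-maximum G = maximum
    (λ k → anyVec? k (isConnectedMatching? G))
    ([] , ([] , []) , [])
    n
    λ { _ (M , isM , _) → matching-size≤n G M isM }

  cm : Graph n → ℕ
  cm G = proj₁ (cm-maximum G)

------------------------------------------------------------------------
-- The conjecture and its minimal counterexamples

ConjectureAt : ℕ → Set₁
ConjectureAt t = (G : Graph (4 * t ∸ 1)) → α G ≡ 2 → t ≤ cm G

record MinimalCounterexample (t : ℕ) (G : Graph (4 * t ∸ 1)) : Set₁ where
  field
    α≡2      : α G ≡ 2
    cm≤t-1   : cm G ≤ t ∸ 1
    minimal  : ∀ t′ → 1 ≤ t′ → t′ < t → ConjectureAt t′

module Submission where

-- Let H be the complement of G, which is triangle-free, so that the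
-- non-neighbours of a vertex form a clique of G.  A clique of size t can be
-- matched greedily into its outside and so gives cm(G) ≥ t; hence all degrees
-- of H are less than t.  Given |S₁| + |S₂| = t − 3, let A and B be the sets of
-- outside vertices complete to S₁ and to S₂; since α(G) = 2 they cover the
-- outside.  Match S₁ greedily into B and S₂ anywhere outside (or S₂ into A and
-- S₁ anywhere): all these edges are joined through S₁, S₂ or the completeness
-- of B to S₂.  Three more edges are needed.  If |A| and |B| are at least 3,
-- they are found between A and B, and such an edge is joined to everything at
-- S₁ ∪ S₂.  If |A| ≤ 2, they are found inside B with an edge of H between any
-- two of them; then each vertex of S₁ misses at most one of the three, and its
-- partner is chosen to repair this.  The counting needs t ≥ 7; for t ≤ 6 Ramsey's
-- theorem gives a clique of size t.

open import Defs
open import Data.Empty using (⊥; ⊥-elim)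
open import Data.Fin using (Fin)
import Data.Fin as Fin
open import Data.Fin.Properties using (_≟_; suc-injective)
open import Data.Fin.Subset using (Subset; ∣_∣; inside; outside; ⁅_⁆; _∪_) renaming (_∈_ to _∈ˢ_)
open import Data.Fin.Subset.Properties using (x∈⁅x⁆; x∈⁅y⁆⇒x≡y; x∈p∪q⁺; x∈p∪q⁻)
open import Data.List using (List; []; _∷_; _++_; length; map; filter; take; allFin)
open import Data.List.Properties using (length-++; length-++-sucʳ; length-map; length-take; length-tabulate; take++drop≡id)
open import Data.List.Membership.Propositional using (_∈_; _∉_; find; lose)
open import Data.List.Membership.Propositional.Properties
  using (∈-++⁺ˡ; ∈-++⁺ʳ; ∈-++⁻; ∈-∃++; ∈-filter⁺; ∈-filter⁻; ∈-map⁺; ∈-map⁻; ∈-allFin)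
open import Data.List.Relation.Binary.Subset.Propositional using (_⊆_)
open import Data.List.Relation.Unary.All as All using (All; []; _∷_)
import Data.List.Relation.Unary.All.Properties as All
open import Data.List.Relation.Unary.AllPairs as AllPairs using (AllPairs; []; _∷_)
import Data.List.Relation.Unary.AllPairs.Properties as AllPairs
open import Data.List.Relation.Unary.Any using (here; there; any?)
open import Data.List.Relation.Unary.Unique.Propositional using (Unique)
import Data.List.Relation.Unary.Unique.Propositional.Properties as Unique
open import Data.Nat using (ℕ; zero; suc; _+_; _*_; _∸_; _≤_; _<_; z≤n; s≤s; s≤s⁻¹; _≤?_)
open import Data.Nat.Properties hiding (_≟_; _≤?_; suc-injective)
open import Data.Nat.Tactic.RingSolver using (solve-∀)
open import Data.Product using (_×_; _,_; proj₁; proj₂; ∃; uncurry)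
open import Data.Sum using (_⊎_; inj₁; inj₂; [_,_]′)
open import Data.Vec as Vec using (Vec)
import Data.Vec.Relation.Unary.All as VecAll
import Data.Vec.Relation.Unary.AllPairs as VecAllPairs
open import Function using (_∘_)
open import Level using (0ℓ)
open import Relation.Binary using (Rel)
open import Relation.Binary.PropositionalEquality using (_≡_; _≢_; refl; sym; trans; cong; cong₂; subst; subst₂; ≢-sym)
open import Relation.Nullary using (¬_; Dec; yes; no; contradiction)
open import Relation.Nullary.Decidable using (¬?; _×-dec_; _⊎-dec_)

-- A linear inequality is derived from a linear hypothesis by an identity
-- with an explicit slack d.
linear : ∀ {p q l r} d → p ≤ q → l + q + d ≡ r + p → l ≤ r
linear {p} {q} {l} {r} d p≤q eq = +-cancelʳ-≤ q l r (begin
  l + q      ≤⟨ m≤m+n (l + q) d ⟩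
  l + q + d  ≡⟨ eq ⟩
  r + p      ≤⟨ +-monoʳ-≤ r p≤q ⟩
  r + q      ∎)
  where open ≤-Reasoning

-- Lists as finite sets.

module _ {A : Set} where

  ∈∉⇒≢ : ∀ {x y : A} {S} → x ∈ S → y ∉ S → x ≢ y
  ∈∉⇒≢ x∈ y∉ refl = y∉ x∈

  unique-⊆-length : {xs ys : List A} → Unique xs → xs ⊆ ys → length xs ≤ length ys
  unique-⊆-length []                    xs⊆ys = z≤n
  unique-⊆-length {x ∷ xs} (x∉xs ∷ xs!) xs⊆ys with ∈-∃++ (xs⊆ys (here refl))
  ... | us , vs , refl = ≤-trans (s≤s (unique-⊆-length xs! xs⊆us++vs))
                                 (≤-reflexive (sym (length-++-sucʳ us x vs)))
    where
    xs⊆us++vs : xs ⊆ us ++ vs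
    xs⊆us++vs y∈xs with ∈-++⁻ us (xs⊆ys (there y∈xs))
    ... | inj₁ y∈us          = ∈-++⁺ˡ y∈us
    ... | inj₂ (here refl)   = contradiction refl (All.lookup x∉xs y∈xs)
    ... | inj₂ (there y∈vs)  = ∈-++⁺ʳ us y∈vs

  ∈-take⁻ : ∀ m {xs : List A} {x} → x ∈ take m xs → x ∈ xs
  ∈-take⁻ m {xs} x∈ = subst (_ ∈_) (take++drop≡id m xs) (∈-++⁺ˡ x∈)

  length-take-≤ : ∀ {m} {xs : List A} → m ≤ length xs → length (take m xs) ≡ m
  length-take-≤ {m} {xs} m≤ = trans (length-take m xs) (m≤n⇒m⊓n≡m m≤)

  AllPairs-lookup : {R : Rel A 0ℓ} {xs ys : List A} →
                    (∀ {x y} → x ∈ xs → y ∈ ys → R x y) → All (λ x → All (R x) ys) xs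
  AllPairs-lookup r = All.tabulate λ x∈ → All.tabulate λ y∈ → r x∈ y∈

-- Choosing vertices outside a given list.

module _ {n : ℕ} where

  _∈?_ : (x : Fin n) (E : List (Fin n)) → Dec (x ∈ E)
  x ∈? E = any? (x ≟_) E

  -- Pigeonhole. Partners in matchings are chosen in this way: `E` concatenates everything to be
  -- avoided, and repetitions in it only weaken the count.
  unique-∉ : {U E : List (Fin n)} → Unique U → length E < length U →
             ∃ λ y → y ∈ U × y ∉ E
  unique-∉ {U} {E} U! E<U with any? (λ y → ¬? (y ∈? E)) U
  ... | yes y∉ = find y∉
  ... | no  ¬∉ = contradiction (unique-⊆-length U! U⊆E) (<⇒≱ E<U)
    where
    U⊆E : U ⊆ E
    U⊆E {y} y∈U with y ∈? E
    ... | yes y∈E = y∈E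
    ... | no  y∉E = contradiction (lose y∈U y∉E) ¬∉

  _⊝_ : List (Fin n) → List (Fin n) → List (Fin n)
  U ⊝ E = filter (λ y → ¬? (y ∈? E)) U

  ⊝-unique : ∀ {U} E → Unique U → Unique (U ⊝ E)
  ⊝-unique E = Unique.filter⁺ (λ y → ¬? (y ∈? E))

  ∈-⊝⁻ : ∀ {U} E {y} → y ∈ U ⊝ E → y ∈ U × y ∉ E
  ∈-⊝⁻ {U} E = ∈-filter⁻ (λ y → ¬? (y ∈? E)) {xs = U}

  ∈-⊝⁺ : ∀ {U} E {y} → y ∈ U → y ∉ E → y ∈ U ⊝ E
  ∈-⊝⁺ E = ∈-filter⁺ (λ y → ¬? (y ∈? E))

  length-⊝ : ∀ {U} E → Unique U → length U ≤ length E + length (U ⊝ E)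
  length-⊝ {U} E U! = ≤-trans (unique-⊆-length U! sub) (≤-reflexive (length-++ E))
    where
    sub : U ⊆ E ++ (U ⊝ E)
    sub {y} y∈U with y ∈? E
    ... | yes y∈E = ∈-++⁺ˡ y∈E
    ... | no  y∉E = ∈-++⁺ʳ E (∈-⊝⁺ E y∈U y∉E)

  three-elements : {U : List (Fin n)} → Unique U → 3 ≤ length U → ∃ λ p → ∃ λ q → ∃ λ r →
    (p ∈ U × q ∈ U × r ∈ U) × p ≢ q × p ≢ r × q ≢ r
  three-elements {p ∷ q ∷ r ∷ _} ((p≢q ∷ p≢r ∷ _) ∷ (q≢r ∷ _) ∷ _) _ =
    p , q , r , (here refl , there (here refl) , there (there (here refl))) , p≢q , p≢r , q≢r
  three-elements {_ ∷ _ ∷ []} _ (s≤s (s≤s ()))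
  three-elements {_ ∷ []}     _ (s≤s ())

  -- Meant for edges pᵢvᵢ with pᵢ in A and vᵢ in B. As A and B may overlap, disjointness of these
  -- edges requires that each vᵢ avoid all of `ps`.
  Partners : (U ps N₁ N₂ N₃ : List (Fin n)) → Set
  Partners U ps N₁ N₂ N₃ = ∃ λ v₁ → ∃ λ v₂ → ∃ λ v₃ → (v₁ ∈ U × v₂ ∈ U × v₃ ∈ U) ×
    (v₁ ∉ N₁ × v₂ ∉ N₂ × v₃ ∉ N₃) × (v₁ ∉ ps × v₂ ∉ ps × v₃ ∉ ps) × v₁ ≢ v₂ × v₁ ≢ v₃ × v₂ ≢ v₃

  -- Greedy choice: besides `ps` and its own list, each vᵢ avoids at most two earlier choices, and
  -- the 3 in the hypotheses leaves one vertex over.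
  three-partners : ∀ {U} ps N₁ N₂ N₃ → Unique U →
    3 + (length ps + length N₁) ≤ length U →
    3 + (length ps + length N₂) ≤ length U →
    3 + (length ps + length N₃) ≤ length U →
    Partners U ps N₁ N₂ N₃
  three-partners {U} ps N₁ N₂ N₃ U! room₁ room₂ room₃ =
    let v₁ , v₁∈ , v₁∉ = pick [] (s≤s z≤n) room₁
        v₂ , v₂∈ , v₂∉ = pick (v₁ ∷ []) (s≤s (s≤s z≤n)) room₂
        v₃ , v₃∈ , v₃∉ = pick (v₁ ∷ v₂ ∷ []) ≤-refl room₃
    in v₁ , v₂ , v₃ , (v₁∈ , v₂∈ , v₃∈)
     , (v₁∉ ∘ ∈-++⁺ʳ ps , v₂∉ ∘ there ∘ ∈-++⁺ʳ ps , v₃∉ ∘ there ∘ there ∘ ∈-++⁺ʳ ps)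
     , (v₁∉ ∘ ∈-++⁺ˡ , v₂∉ ∘ there ∘ ∈-++⁺ˡ , v₃∉ ∘ there ∘ there ∘ ∈-++⁺ˡ)
     , ∈∉⇒≢ (here refl) v₂∉ , ∈∉⇒≢ (here refl) v₃∉ , ∈∉⇒≢ (there (here refl)) v₃∉
    where
    pick : ∀ vs {N} → length vs < 3 → 3 + (length ps + length N) ≤ length U →
           ∃ λ v → v ∈ U × v ∉ vs ++ (ps ++ N)
    pick vs {N} vs<3 room = unique-∉ U! (≤-trans
      (≤-reflexive (cong suc (trans (length-++ vs) (cong (length vs +_) (length-++ ps)))))
      (≤-trans (+-monoˡ-≤ (length ps + length N) vs<3) room))

-- Subsets as duplicate-free lists.

elements : ∀ {n} → Subset n → List (Fin n)
elements Vec.[]              = []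
elements (inside  Vec.∷ S) = Fin.zero ∷ map Fin.suc (elements S)
elements (outside Vec.∷ S) = map Fin.suc (elements S)

length-elements : ∀ {n} (S : Subset n) → length (elements S) ≡ ∣ S ∣
length-elements Vec.[]              = refl
length-elements (inside  Vec.∷ S) = cong suc (trans (length-map Fin.suc (elements S)) (length-elements S))
length-elements (outside Vec.∷ S) = trans (length-map Fin.suc (elements S)) (length-elements S)

∈-elements⁻ : ∀ {n} (S : Subset n) {x} → x ∈ elements S → x ∈ˢ S
∈-elements⁻ (inside  Vec.∷ S) (here refl) = Vec.here
∈-elements⁻ (inside  Vec.∷ S) (there x∈) with ∈-map⁻ Fin.suc x∈
... | y , y∈ , refl = Vec.there (∈-elements⁻ S y∈)
∈-elements⁻ (outside Vec.∷ S) x∈ with ∈-map⁻ Fin.suc x∈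
... | y , y∈ , refl = Vec.there (∈-elements⁻ S y∈)

∈-elements⁺ : ∀ {n} (S : Subset n) {x} → x ∈ˢ S → x ∈ elements S
∈-elements⁺ (inside  Vec.∷ S) Vec.here       = here refl
∈-elements⁺ (inside  Vec.∷ S) (Vec.there x∈) = there (∈-map⁺ Fin.suc (∈-elements⁺ S x∈))
∈-elements⁺ (outside Vec.∷ S) (Vec.there x∈) = ∈-map⁺ Fin.suc (∈-elements⁺ S x∈)

elements-unique : ∀ {n} (S : Subset n) → Unique (elements S)
elements-unique Vec.[]              = []
elements-unique (inside  Vec.∷ S) =
  All.tabulate (λ x∈ 0≡x → 0∉ (subst (_∈ _) (sym 0≡x) x∈)) ∷ Unique.map⁺ suc-injective (elements-unique S)
  where
  0∉ : Fin.zero ∉ map Fin.suc (elements S)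
  0∉ z with ∈-map⁻ Fin.suc z
  ... | _ , _ , ()
elements-unique (outside Vec.∷ S) = Unique.map⁺ suc-injective (elements-unique S)

-- The complement graph, and connected matchings as lists.

module _ {n : ℕ} (G : Graph n) where

  Edge : Set
  Edge = Fin n × Fin n

  Clique : List (Fin n) → Set
  Clique C = ∀ {x y} → x ∈ C → y ∈ C → x ≢ y → Adj G x y

  -- Adjacency in the complement H; accordingly `nonNbrs x` is the neighbourhood of x in H and does
  -- not contain x.
  NonAdj : Rel (Fin n) 0ℓ
  NonAdj x y = x ≢ y × ¬ Adj G x y

  NonAdj-sym : ∀ {x y} → NonAdj x y → NonAdj y x
  NonAdj-sym (x≢y , ¬xy) = ≢-sym x≢y , ¬xy ∘ symm G

  nonAdj? : ∀ x y → Dec (NonAdj x y)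
  nonAdj? x y = ¬? (x ≟ y) ×-dec ¬? (adj? G x y)

  adj-or-nonAdj : ∀ {x y} → x ≢ y → Adj G x y ⊎ NonAdj x y
  adj-or-nonAdj {x} {y} x≢y with adj? G x y
  ... | yes xy = inj₁ xy
  ... | no ¬xy = inj₂ (x≢y , ¬xy)

  adj⇒≢ : ∀ {x y} → Adj G x y → x ≢ y
  adj⇒≢ xy x≡y = irrefl G x≡y xy

  nonNbrs : Fin n → List (Fin n)
  nonNbrs x = filter (nonAdj? x) (allFin n)

  nonNbrs-unique : ∀ x → Unique (nonNbrs x)
  nonNbrs-unique x = Unique.filter⁺ (nonAdj? x) (Unique.allFin⁺ n)

  ∈-nonNbrs⁺ : ∀ {x y} → NonAdj x y → y ∈ nonNbrs x
  ∈-nonNbrs⁺ {x} {y} = ∈-filter⁺ (nonAdj? x) (∈-allFin y)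

  ∈-nonNbrs⁻ : ∀ {x y} → y ∈ nonNbrs x → NonAdj x y
  ∈-nonNbrs⁻ {x} y∈ = proj₂ (∈-filter⁻ (nonAdj? x) {xs = allFin n} y∈)

  adj-outside : ∀ {x y} → x ≢ y → y ∉ nonNbrs x → Adj G x y
  adj-outside x≢y y∉N with adj-or-nonAdj x≢y
  ... | inj₁ xy = xy
  ... | inj₂ xy = contradiction (∈-nonNbrs⁺ xy) y∉N

  Linked : Rel Edge 0ℓ
  Linked e f = VertexDisjoint e f × Joined G e f

  ConnectedMatching : List Edge → Set
  ConnectedMatching L = All (uncurry (Adj G)) L × AllPairs Linked L

  All-fromList : {P : Edge → Set} {L : List Edge} → All P L → VecAll.All P (Vec.fromList L)
  All-fromList []       = VecAll.[]
  All-fromList (p ∷ ps) = p VecAll.∷ All-fromList ps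

  AllPairs-fromList : {R S : Rel Edge 0ℓ} {L : List Edge} → (∀ {e f} → R e f → S e f) →
                      AllPairs R L → VecAllPairs.AllPairs S (Vec.fromList L)
  AllPairs-fromList R⇒S []       = VecAllPairs.[]
  AllPairs-fromList R⇒S (p ∷ ps) = All-fromList (All.map R⇒S p) VecAllPairs.∷ AllPairs-fromList R⇒S ps

  length≤cm : ∀ {L} → ConnectedMatching L → length L ≤ cm G
  length≤cm {L} (edges , linked) = proj₂ (proj₂ (cm-maximum G)) (length L)
    ( Vec.fromList L
    , (All-fromList edges , AllPairs-fromList proj₁ linked)
    , AllPairs-fromList proj₂ linked)

  -- Triangle-freeness of H, the form in which the independence number enters everything below.
  α≤2⇒no-independent-triple : α G ≤ 2 → ∀ {x y z} → NonAdj x y → NonAdj x z → NonAdj y z → ⊥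
  α≤2⇒no-independent-triple α≤2 {x} {y} {z} xy xz yz = <⇒≱ three (≤-trans ≤α α≤2)
    where
    xs = x ∷ y ∷ z ∷ []
    S = ⁅ x ⁆ ∪ (⁅ y ⁆ ∪ ⁅ z ⁆)
    sub : xs ⊆ elements S
    sub (here refl)                 = ∈-elements⁺ S (x∈p∪q⁺ (inj₁ (x∈⁅x⁆ x)))
    sub (there (here refl))         = ∈-elements⁺ S (x∈p∪q⁺ {p = ⁅ x ⁆} (inj₂ (x∈p∪q⁺ (inj₁ (x∈⁅x⁆ y)))))
    sub (there (there (here refl))) = ∈-elements⁺ S (x∈p∪q⁺ {p = ⁅ x ⁆} (inj₂ (x∈p∪q⁺ {p = ⁅ y ⁆} (inj₂ (x∈⁅x⁆ z)))))
    sup : ∀ {w} → w ∈ˢ S → w ∈ xs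
    sup w∈ with x∈p∪q⁻ ⁅ x ⁆ _ w∈
    ... | inj₁ w∈x = here (x∈⁅y⁆⇒x≡y x w∈x)
    ... | inj₂ w∈yz with x∈p∪q⁻ ⁅ y ⁆ _ w∈yz
    ...   | inj₁ w∈y = there (here (x∈⁅y⁆⇒x≡y y w∈y))
    ...   | inj₂ w∈z = there (there (here (x∈⁅y⁆⇒x≡y z w∈z)))
    indep : ∀ {v w} → v ∈ xs → w ∈ xs → ¬ Adj G v w
    indep (here refl) (here refl)                                 = irrefl G refl
    indep (here refl) (there (here refl))                         = proj₂ xy
    indep (here refl) (there (there (here refl)))                 = proj₂ xz
    indep (there (here refl)) (here refl)                         = proj₂ xy ∘ symm G
    indep (there (here refl)) (there (here refl))                 = irrefl G refl
    indep (there (here refl)) (there (there (here refl)))         = proj₂ yz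
    indep (there (there (here refl))) (here refl)                 = proj₂ xz ∘ symm G
    indep (there (there (here refl))) (there (here refl))         = proj₂ yz ∘ symm G
    indep (there (there (here refl))) (there (there (here refl))) = irrefl G refl
    three : 3 ≤ ∣ S ∣
    three = subst (3 ≤_) (length-elements S) (unique-⊆-length
      ((proj₁ xy ∷ proj₁ xz ∷ []) ∷ (proj₁ yz ∷ []) ∷ [] ∷ []) sub)
    ≤α : ∣ S ∣ ≤ α G
    ≤α = proj₂ (proj₂ (α-maximum G)) ∣ S ∣ (S , (λ v w v∈ w∈ → indep (sup v∈) (sup w∈)) , refl)

  -- Greedy matching of cliques.

  Available : (Fin n → Fin n → Set) → ℕ → Fin n → Set
  Available P m x = ∀ E → length E < m → ∃ λ y → P x y × y ∉ E

  record Pairing (P : Fin n → Fin n → Set) (F X : List (Fin n)) : Set where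
    field
      pairs    : List Edge
      size     : length pairs ≡ length X
      good     : ∀ {e} → e ∈ pairs → proj₁ e ∈ X × P (proj₁ e) (proj₂ e) × proj₂ e ∉ F
      distinct : AllPairs (λ e f → proj₁ e ≢ proj₁ f × proj₂ e ≢ proj₂ f) pairs

  -- `F` holds the blocked vertices. Each chosen partner moves into `F` as its vertex leaves `X`, so
  -- the sum of the two lengths is invariant and fewer than m vertices are blocked at every choice.
  -- That partners lie outside `X` is left to `P`.
  greedyPairing : ∀ {P m} F X → Unique X → (∀ {x} → x ∈ X → Available P m x) →
                  length F + length X ≤ m → Pairing P F X
  greedyPairing F [] _ _ _ = record { pairs = [] ; size = refl ; good = λ () ; distinct = [] }
  greedyPairing {P} {m} F (x ∷ X) (x∉X ∷ X!) avail F+X≤m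
    with avail (here refl) F (≤-trans (m≤m+n (suc (length F)) (length X))
           (≤-trans (≤-reflexive (sym (+-suc (length F) (length X)))) F+X≤m))
  ... | y , Pxy , y∉F = record
    { pairs    = (x , y) ∷ pairs
    ; size     = cong suc size
    ; good     = λ { (here refl) → here refl , Pxy , y∉F
                   ; (there e∈)  → let e₁∈X , Pe , e₂∉ = good e∈ in there e₁∈X , Pe , e₂∉ ∘ there }
    ; distinct = All.tabulate (λ e∈ → let e₁∈X , Pe , e₂∉ = good e∈ in
                   All.lookup x∉X e₁∈X , λ y≡e₂ → e₂∉ (here (sym y≡e₂))) ∷ distinct
    }
    where
    open Pairing (greedyPairing {P} {m} (y ∷ F) X X! (avail ∘ there)
           (≤-trans (≤-reflexive (sym (+-suc (length F) (length X)))) F+X≤m))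

  ends : List Edge → List (Fin n)
  ends []             = []
  ends ((u , v) ∷ es) = u ∷ v ∷ ends es

  ∈-ends₁ : ∀ {e es} → e ∈ es → proj₁ e ∈ ends es
  ∈-ends₁ (here refl) = here refl
  ∈-ends₁ (there e∈)  = there (there (∈-ends₁ e∈))

  ∈-ends₂ : ∀ {e es} → e ∈ es → proj₂ e ∈ ends es
  ∈-ends₂ (here refl) = there (here refl)
  ∈-ends₂ (there e∈)  = there (there (∈-ends₂ e∈))

  -- Two disjoint cliques; the partners of S₁ are asked to be complete to S₂,
  -- which joins every edge at S₁ to every edge at S₂.
  module _ (S₁ S₂ : List (Fin n)) (es : List Edge) where

    Outside : Fin n → Set
    Outside y = y ∉ S₁ × y ∉ S₂

    Partner : Fin n → Fin n → Set
    Partner x y = Adj G x y × Outside y × (∀ {e} → e ∈ es → Joined G e (x , y))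

    Partner₁ : Fin n → Fin n → Set
    Partner₁ x y = Partner x y × (∀ {z} → z ∈ S₂ → Adj G y z)

    cliques-matching :
      Unique S₁ → Unique S₂ → Clique S₁ → Clique S₂ → (∀ {x} → x ∈ S₁ → x ∉ S₂) →
      ConnectedMatching es → (∀ {y} → y ∈ ends es → Outside y) →
      (∀ {x} → x ∈ S₁ → Available Partner₁ (length (ends es) + length S₁) x) →
      (∀ {x} → x ∈ S₂ → Available Partner (length (ends es) + (length S₁ + length S₂)) x) →
      ∃ λ L → ConnectedMatching L × length L ≡ length es + (length S₁ + length S₂)
    cliques-matching S₁! S₂! cl₁ cl₂ disj (es-edges , es-linked) es-out av₁ av₂ =
      es ++ (L₁ ++ L₂) , (edges , linked) , len
      where
      module P₁ = Pairing (greedyPairing (ends es) S₁ S₁! av₁ ≤-refl)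
      L₁ = P₁.pairs
      -- S₂ is matched second and must avoid the partners of S₁ too, whence the larger availability
      -- asked of its vertices.
      F₂ = map proj₂ L₁ ++ ends es

      F₂-length : length F₂ + length S₂ ≡ length (ends es) + (length S₁ + length S₂)
      F₂-length = trans (cong (_+ length S₂)
        (trans (length-++ (map proj₂ L₁))
          (trans (cong (_+ length (ends es)) (trans (length-map proj₂ L₁) P₁.size))
                 (+-comm (length S₁) (length (ends es))))))
        (+-assoc (length (ends es)) (length S₁) (length S₂))

      module P₂ = Pairing (greedyPairing F₂ S₂ S₂! av₂ (≤-reflexive F₂-length))
      L₂ = P₂.pairs

      good₁ : ∀ {e} → e ∈ L₁ → proj₁ e ∈ S₁ × Partner₁ (proj₁ e) (proj₂ e) × proj₂ e ∉ ends es
      good₁ = P₁.good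
      good₂ : ∀ {e} → e ∈ L₂ → proj₁ e ∈ S₂ × Partner (proj₁ e) (proj₂ e) × proj₂ e ∉ F₂
      good₂ = P₂.good

      len : length (es ++ (L₁ ++ L₂)) ≡ length es + (length S₁ + length S₂)
      len = trans (length-++ es) (cong (length es +_)
              (trans (length-++ L₁) (cong₂ _+_ P₁.size P₂.size)))

      edges : All (uncurry (Adj G)) (es ++ (L₁ ++ L₂))
      edges = All.++⁺ es-edges (All.++⁺
        (All.tabulate λ e∈ → let _ , ((xy , _) , _) , _ = good₁ e∈ in xy)
        (All.tabulate λ e∈ → let _ , (xy , _) , _ = good₂ e∈ in xy))

      ends-vs : ∀ {S e x y} → (∀ {z} → z ∈ ends es → z ∉ S) → e ∈ es → x ∈ S → y ∉ ends es →
                VertexDisjoint e (x , y)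
      ends-vs out e∈ x∈ y∉ =
        ≢-sym (∈∉⇒≢ x∈ (out (∈-ends₁ e∈))) , ∈∉⇒≢ (∈-ends₁ e∈) y∉ ,
        ≢-sym (∈∉⇒≢ x∈ (out (∈-ends₂ e∈))) , ∈∉⇒≢ (∈-ends₂ e∈) y∉

      es-L₁ : ∀ {e f} → e ∈ es → f ∈ L₁ → Linked e f
      es-L₁ e∈ f∈ = let x∈ , ((_ , _ , joined) , _) , y∉ = good₁ f∈ in
        ends-vs (proj₁ ∘ es-out) e∈ x∈ y∉ , joined e∈

      es-L₂ : ∀ {e f} → e ∈ es → f ∈ L₂ → Linked e f
      es-L₂ e∈ f∈ = let x∈ , (_ , _ , joined) , y∉ = good₂ f∈ in
        ends-vs (proj₂ ∘ es-out) e∈ x∈ (y∉ ∘ ∈-++⁺ʳ (map proj₂ L₁)) , joined e∈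

      L₁-L₂ : ∀ {e f} → e ∈ L₁ → f ∈ L₂ → Linked e f
      L₁-L₂ e∈ f∈ =
        let x∈ , ((_ , (_ , y∉S₂) , _) , y-S₂) , _ = good₁ e∈
            z∈ , (_ , (w∉S₁ , _) , _) , w∉         = good₂ f∈
        in ( ≢-sym (∈∉⇒≢ z∈ (disj x∈)) , ∈∉⇒≢ x∈ w∉S₁ , ≢-sym (∈∉⇒≢ z∈ y∉S₂)
           , ∈∉⇒≢ (∈-++⁺ˡ (∈-map⁺ proj₂ e∈)) w∉ )
           , inj₂ (inj₂ (inj₁ (y-S₂ z∈)))

      within : ∀ {S L} → Clique S → (∀ {e} → e ∈ L → proj₁ e ∈ S × proj₂ e ∉ S) →
               AllPairs (λ e f → proj₁ e ≢ proj₁ f × proj₂ e ≢ proj₂ f) L → AllPairs Linked L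
      within cl ends∈ []         = []
      within cl ends∈ (d ∷ dist) =
        All.tabulate (λ f∈ →
          let x≢z , y≢w = All.lookup d f∈
              x∈ , y∉   = ends∈ (here refl)
              z∈ , w∉   = ends∈ (there f∈)
          in (x≢z , ∈∉⇒≢ x∈ w∉ , ≢-sym (∈∉⇒≢ z∈ y∉) , y≢w) , inj₁ (cl x∈ z∈ x≢z))
        ∷ within cl (ends∈ ∘ there) dist

      linked : AllPairs Linked (es ++ (L₁ ++ L₂))
      linked = AllPairs.++⁺ es-linked
        (AllPairs.++⁺
          (within cl₁ (λ e∈ → let x∈ , ((_ , (y∉ , _) , _) , _) , _ = good₁ e∈ in x∈ , y∉) P₁.distinct)
          (within cl₂ (λ e∈ → let x∈ , (_ , (_ , y∉) , _) , _ = good₂ e∈ in x∈ , y∉) P₂.distinct)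
          (AllPairs-lookup L₁-L₂))
        (AllPairs-lookup λ e∈ f∈ → [ es-L₁ e∈ , es-L₂ e∈ ]′ (∈-++⁻ L₁ f∈))

  -- Ramsey's bound for a triangle-free complement.

  triangular : ℕ → ℕ
  triangular zero    = 0
  triangular (suc k) = suc k + triangular k

  module _ (no-triple : ∀ {x y z} → NonAdj x y → NonAdj x z → NonAdj y z → ⊥) where

    nonNbrs-clique : ∀ x → Clique (nonNbrs x)
    nonNbrs-clique x y∈ z∈ y≢z with adj-or-nonAdj y≢z
    ... | inj₁ yz = yz
    ... | inj₂ yz = ⊥-elim (no-triple (∈-nonNbrs⁻ y∈) (∈-nonNbrs⁻ z∈) yz)

    -- The classical bound R(3, k) ≤ k(k+1)/2. For a clique of size k + 1, take a vertex v: either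
    -- it has more than k non-neighbours in U, which form a clique, or deleting at most k of them
    -- leaves enough neighbours for a clique of size k, to which v is added.
    ramsey : ∀ k {U} → Unique U → triangular k ≤ length U →
             ∃ λ C → Unique C × Clique C × C ⊆ U × k ≤ length C
    ramsey zero    _ _ = [] , [] , (λ ()) , (λ ()) , z≤n
    ramsey (suc k) {v ∷ U} (v∉U ∷ U!) (s≤s k+tri≤U) with suc k ≤? length N
      where N = filter (nonAdj? v) U
    ... | yes k<N = N , Unique.filter⁺ (nonAdj? v) U! ,
        (λ x∈ y∈ → nonNbrs-clique v (in-nonNbrs x∈) (in-nonNbrs y∈)) ,
        (λ x∈ → there (proj₁ (∈-filter⁻ (nonAdj? v) {xs = U} x∈))) , k<N
      where
      N = filter (nonAdj? v) U
      in-nonNbrs : ∀ {x} → x ∈ N → x ∈ nonNbrs v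
      in-nonNbrs x∈ = ∈-nonNbrs⁺ (proj₂ (∈-filter⁻ (nonAdj? v) {xs = U} x∈))
    ... | no  k≮N with ramsey k (Unique.filter⁺ (adj? G v) U!) tri≤M
      where
      N = filter (nonAdj? v) U
      M = filter (adj? G v) U
      U⊆N++M : U ⊆ N ++ M
      U⊆N++M {x} x∈ with adj-or-nonAdj (All.lookup v∉U x∈)
      ... | inj₁ vx = ∈-++⁺ʳ N (∈-filter⁺ (adj? G v) x∈ vx)
      ... | inj₂ vx = ∈-++⁺ˡ (∈-filter⁺ (nonAdj? v) x∈ vx)
      tri≤M : triangular k ≤ length M
      tri≤M = +-cancelˡ-≤ k _ _ (≤-trans k+tri≤U (≤-trans (unique-⊆-length U! U⊆N++M)
        (≤-trans (≤-reflexive (length-++ N)) (+-monoˡ-≤ (length M) (s≤s⁻¹ (≰⇒> k≮N))))))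
    ...   | C , C! , cl , C⊆M , k≤C =
        v ∷ C , All.tabulate (λ x∈ → adj⇒≢ (v-adj x∈)) ∷ C! , clique , sub , s≤s k≤C
      where
      v-adj : ∀ {x} → x ∈ C → Adj G v x
      v-adj x∈ = proj₂ (∈-filter⁻ (adj? G v) {xs = U} (C⊆M x∈))
      clique : Clique (v ∷ C)
      clique (here refl) (here refl) v≢v = contradiction refl v≢v
      clique (here refl) (there y∈)  _   = v-adj y∈
      clique (there x∈)  (here refl) _   = symm G (v-adj x∈)
      clique (there x∈)  (there y∈)  x≢y = cl x∈ y∈ x≢y
      sub : v ∷ C ⊆ v ∷ U
      sub (here refl) = here refl
      sub (there x∈)  = there (proj₁ (∈-filter⁻ (adj? G v) {xs = U} (C⊆M x∈)))

    -- Clique sizes in G and degrees in the complement.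

    module _ (t : ℕ) (n≡ : suc n ≡ 4 * t)
             (small : ∀ {L} → ConnectedMatching L → length L < t) where

      all-length : suc (length (allFin n)) ≡ 4 * t
      all-length = trans (cong suc (length-tabulate (λ (i : Fin n) → i))) n≡

      -- The case of one clique and no further edges: a matching of T into its outside is connected
      -- through T alone.
      matchable-clique : ∀ {T} → Unique T → Clique T →
                         (∀ {x} → x ∈ T → Available (λ x y → Adj G x y × y ∉ T) (length T) x) →
                         length T < t
      matchable-clique {T} T! cl avail =
        let L , matching , L≡ = cliques-matching T [] [] T! [] cl (λ ()) (λ _ ()) ([] , []) (λ ())
              (λ x∈ E E<T → let y , (xy , y∉T) , y∉E = avail x∈ E E<T in
                y , ((xy , (y∉T , λ ()) , λ ()) , λ ()) , y∉E)
              (λ ())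
        in subst (_< t) (trans L≡ (+-identityʳ (length T))) (small matching)

      take-t : ∀ {C} → Unique C → Clique C → t ≤ length C →
               Unique (take t C) × Clique (take t C) × length (take t C) ≡ t
      take-t C! cl t≤C = Unique.take⁺ t C! , (λ x∈ y∈ → cl (∈-take⁻ t x∈) (∈-take⁻ t y∈)) , length-take-≤ t≤C

      -- The first t vertices are matched into the others.
      no-2t-clique : ∀ {C} → Unique C → Clique C → length C < t + t
      no-2t-clique {C} C! cl = ≰⇒> λ 2t≤C →
        let t≤C = ≤-trans (m≤m+n t t) 2t≤C
            T = take t C
            T! , T-cl , T≡ = take-t C! cl t≤C
            t≤D : t ≤ length (C ⊝ T)
            t≤D = +-cancelˡ-≤ t _ _ (≤-trans 2t≤C (≤-trans (length-⊝ T C!)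
                    (≤-reflexive (cong (_+ length (C ⊝ T)) T≡))))
            avail : ∀ {x} → x ∈ T → Available (λ x y → Adj G x y × y ∉ T) (length T) x
            avail x∈ E E<T =
              let y , y∈D , y∉E = unique-∉ (⊝-unique T C!) (≤-trans E<T (≤-trans (≤-reflexive T≡) t≤D))
                  y∈C , y∉T = ∈-⊝⁻ T y∈D
              in y , (cl (∈-take⁻ t x∈) y∈C (∈∉⇒≢ x∈ y∉T) , y∉T) , y∉E
        in <⇒≢ (matchable-clique T! T-cl avail) T≡

      nonNbrs<2t : ∀ x → length (nonNbrs x) < t + t
      nonNbrs<2t x = no-2t-clique (nonNbrs-unique x) (nonNbrs-clique x)

      -- Bootstraps from the cruder degree bound 2t - 1. For a vertex of a t-clique T, at most t - 1
      -- vertices are used, t lie in T and 2t - 1 are non-neighbours; of the 4t - 1 vertices at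
      -- least one remains as a partner.
      no-t-clique : ∀ {C} → Unique C → Clique C → length C < t
      no-t-clique {C} C! cl = ≰⇒> λ t≤C →
        let T = take t C
            T! , T-cl , T≡ = take-t C! cl t≤C
        in <⇒≢ (matchable-clique T! T-cl (avail T T≡)) T≡
        where
        identity : ∀ e t m → suc (suc (e + (t + m))) + (t + (t + t)) + 0 ≡ 4 * t + (suc e + suc m)
        identity = solve-∀
        room : ∀ T E x → length T ≡ t → length E < length T →
               length (E ++ (T ++ nonNbrs x)) < length (allFin n)
        room T E x T≡ E<T = s≤s⁻¹ (begin
          suc (suc (length (E ++ (T ++ N))))             ≡⟨ cong (suc ∘ suc) (trans (length-++ E) (cong (length E +_) (length-++ T))) ⟩
          suc (suc (length E + (length T + length N)))   ≡⟨ cong (λ m → suc (suc (length E + (m + length N)))) T≡ ⟩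
          suc (suc (length E + (t + length N)))          ≤⟨ linear 0 (+-mono-≤ (subst (length E <_) T≡ E<T) (nonNbrs<2t x))
                                                              (identity (length E) t (length N)) ⟩
          4 * t                                          ≡⟨ all-length ⟨
          suc (length (allFin n))                        ∎)
          where
          open ≤-Reasoning
          N = nonNbrs x
        avail : ∀ T → length T ≡ t → ∀ {x} → x ∈ T → Available (λ x y → Adj G x y × y ∉ T) (length T) x
        avail T T≡ {x} x∈ E E<T =
          let y , _ , y∉ = unique-∉ (Unique.allFin⁺ n) (room T E x T≡ E<T)
              y∉T = y∉ ∘ ∈-++⁺ʳ E ∘ ∈-++⁺ˡ
          in y , (adj-outside (∈∉⇒≢ x∈ y∉T) (y∉ ∘ ∈-++⁺ʳ E ∘ ∈-++⁺ʳ T) , y∉T) , y∉ ∘ ∈-++⁺ˡ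

      nonNbrs<t : ∀ x → length (nonNbrs x) < t
      nonNbrs<t x = no-t-clique (nonNbrs-unique x) (nonNbrs-clique x)

      nonAdj-pair : ∀ {U} → Unique U → t ≤ length U →
                    ∃ λ x → ∃ λ y → x ∈ U × y ∈ U × NonAdj x y
      nonAdj-pair {U} U! t≤U with any? (λ x → any? (nonAdj? x) U) U
      ... | yes a = let x , x∈ , b = find a ; y , y∈ , xy = find b in x , y , x∈ , y∈ , xy
      ... | no ¬a = contradiction (no-t-clique U! clique) (≤⇒≯ t≤U)
        where
        clique : Clique U
        clique x∈ y∈ x≢y with adj-or-nonAdj x≢y
        ... | inj₁ xy = xy
        ... | inj₂ xy = contradiction (lose x∈ (lose y∈ xy)) ¬a

      -- Ramsey's bound for (3, t) settles t ≤ 6, as t(t+1)/2 ≤ 4t − 1 there.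
      t≥7 : 1 ≤ t → 7 ≤ t
      t≥7 1≤t with 7 ≤? t
      ... | yes p = p
      ... | no ¬p = ⊥-elim (impossible (tri t 1≤t (s≤s⁻¹ (≰⇒> ¬p))))
        where
        tri : ∀ t → 1 ≤ t → t ≤ 6 → suc (triangular t) ≤ 4 * t
        tri 1 _ _ = ≤ᵇ⇒≤ _ _ _
        tri 2 _ _ = ≤ᵇ⇒≤ _ _ _
        tri 3 _ _ = ≤ᵇ⇒≤ _ _ _
        tri 4 _ _ = ≤ᵇ⇒≤ _ _ _
        tri 5 _ _ = ≤ᵇ⇒≤ _ _ _
        tri 6 _ _ = ≤ᵇ⇒≤ _ _ _
        tri (suc (suc (suc (suc (suc (suc (suc t))))))) _ (s≤s (s≤s (s≤s (s≤s (s≤s (s≤s ()))))))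
        impossible : suc (triangular t) ≤ 4 * t → ⊥
        impossible p with ramsey t (Unique.allFin⁺ n) (s≤s⁻¹ (subst (suc (triangular t) ≤_) (sym all-length) p))
        ... | C , C! , cl , _ , t≤C = <⇒≱ (no-t-clique C! cl) t≤C

      -- Two anti-complete cliques with t - 3 vertices in all.

      module _ (k : ℕ) (t≡ : t ≡ 3 + k) where

        nonNbrs≤ : ∀ x → length (nonNbrs x) ≤ 2 + k
        nonNbrs≤ x = s≤s⁻¹ (subst (length (nonNbrs x) <_) t≡ (nonNbrs<t x))

        all≥ : 11 + 4 * k ≤ length (allFin n)
        all≥ = s≤s⁻¹ (≤-reflexive (sym (trans all-length (trans (cong (4 *_) t≡) (identity k)))))
          where
          identity : ∀ k → 4 * (3 + k) ≡ 12 + 4 * k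
          identity = solve-∀

        far-pair : ∀ {U} → Unique U → 3 + k ≤ length U →
                   ∃ λ x → ∃ λ y → x ∈ U × y ∈ U × NonAdj x y
        far-pair U! k≤U = nonAdj-pair U! (≤-trans (≤-reflexive t≡) k≤U)

        -- The configuration to be refuted, of total size exactly k = t - 3. Stating `anti` with
        -- `NonAdj` includes disjointness of the two cliques.
        record Config (S₁ S₂ : List (Fin n)) : Set where
          field
            unique₁ : Unique S₁
            unique₂ : Unique S₂
            clique₁ : Clique S₁
            clique₂ : Clique S₂
            anti    : ∀ {x y} → x ∈ S₁ → y ∈ S₂ → NonAdj x y
            size    : length S₁ + length S₂ ≡ k

        swap : ∀ {S₁ S₂} → Config S₁ S₂ → Config S₂ S₁
        swap {S₁} {S₂} c = record
          { unique₁ = unique₂ ; unique₂ = unique₁ ; clique₁ = clique₂ ; clique₂ = clique₁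
          ; anti = λ x∈ y∈ → NonAdj-sym (anti y∈ x∈) ; size = trans (+-comm (length S₂) (length S₁)) size }
          where open Config c

        IsFull : (S₁ S₂ : List (Fin n)) → Fin n → Set
        IsFull S₁ S₂ y = (y ∉ S₁ × y ∉ S₂) × All (Adj G y) S₂

        isFull? : ∀ S₁ S₂ y → Dec (IsFull S₁ S₂ y)
        isFull? S₁ S₂ y = (¬? (y ∈? S₁) ×-dec ¬? (y ∈? S₂)) ×-dec All.all? (adj? G y) S₂

        -- `full S₁ S₂` is the set B of vertices complete to S₂; the set A is `full S₂ S₁`.
        full : (S₁ S₂ : List (Fin n)) → List (Fin n)
        full S₁ S₂ = filter (isFull? S₁ S₂) (allFin n)

        full-unique : ∀ S₁ S₂ → Unique (full S₁ S₂)
        full-unique S₁ S₂ = Unique.filter⁺ (isFull? S₁ S₂) (Unique.allFin⁺ n)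

        ∈-full⁻ : ∀ {S₁ S₂ y} → y ∈ full S₁ S₂ → IsFull S₁ S₂ y
        ∈-full⁻ {S₁} {S₂} y∈ = proj₂ (∈-filter⁻ (isFull? S₁ S₂) {xs = allFin n} y∈)

        -- Domination of vertices by edges, and rifts between edges.

        Dominates : Edge → Fin n → Set
        Dominates (u , v) x = Adj G u x ⊎ Adj G v x

        dominates⇒joined : ∀ {e x y} → Dominates e x → Joined G e (x , y)
        dominates⇒joined (inj₁ ux) = inj₁ ux
        dominates⇒joined (inj₂ vx) = inj₂ (inj₂ (inj₁ vx))

        -- An edge of H between e and f. As H is triangle-free, no vertex off e and f can then be
        -- non-adjacent to all four ends.
        Rift : Rel Edge 0ℓ
        Rift e f = ∃ λ p → ∃ λ q → p ∈ ends (e ∷ []) × q ∈ ends (f ∷ []) × NonAdj p q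

        undominated : ∀ {e x p} → ¬ Dominates e x → x ∉ ends (e ∷ []) → p ∈ ends (e ∷ []) → NonAdj x p
        undominated ¬dom x∉ (here refl)         = (λ { refl → x∉ (here refl) }) , ¬dom ∘ inj₁ ∘ symm G
        undominated ¬dom x∉ (there (here refl)) = (λ { refl → x∉ (there (here refl)) }) , ¬dom ∘ inj₂ ∘ symm G

        -- If e and f both missed x, then x and the ends of a rift between e
        -- and f would be independent: so x is missed by at most one edge, and
        -- only the non-neighbours of one end u of that edge have to be avoided.
        forbidden : ∀ {x} es → AllPairs Rift es → x ∉ ends es →
          ∃ λ F → length F ≤ 1 + k ×
            (∀ {y e} → e ∈ es → Adj G x y → y ∉ F → Joined G e (x , y))
        forbidden [] _ _ = [] , z≤n , λ ()
        forbidden {x} ((u , v) ∷ es) (rift ∷ rifts) x∉ with adj? G u x ⊎-dec adj? G v x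
        ... | yes dom = let F , F≤ , joined = forbidden es rifts (x∉ ∘ there ∘ there) in
          F , F≤ , λ { (here refl) _ _ → dominates⇒joined dom ; (there e∈) → joined e∈ }
        ... | no ¬dom = F , F≤ , λ { (here refl) xy y∉F → inj₂ (inj₁ (uy xy y∉F))
                                   ; (there e∈) _ _ → dominates⇒joined (dominated e∈) }
          where
          -- x is itself a non-neighbour of u. Dropping it is harmless, since y is adjacent to x and
          -- so differs from it, and lowers the bound from 2 + k to 1 + k.
          F = nonNbrs u ⊝ (x ∷ [])
          x∉e : x ∉ ends ((u , v) ∷ [])
          x∉e (here refl)         = x∉ (here refl)
          x∉e (there (here refl)) = x∉ (there (here refl))
          xu : NonAdj x u
          xu = undominated ¬dom x∉e (here refl)
          F≤ : length F ≤ 1 + k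
          F≤ = s≤s⁻¹ (≤-trans (unique-⊆-length
                 (All.tabulate (λ y∈ → ≢-sym (proj₂ (∈-⊝⁻ {U = nonNbrs u} (x ∷ []) y∈) ∘ here)) ∷ ⊝-unique (x ∷ []) (nonNbrs-unique u))
                 (λ { (here refl) → ∈-nonNbrs⁺ (NonAdj-sym xu)
                    ; (there y∈) → proj₁ (∈-⊝⁻ {U = nonNbrs u} (x ∷ []) y∈) }))
                 (nonNbrs≤ u))
          uy : ∀ {y} → Adj G x y → y ∉ F → Adj G u y
          uy xy y∉F = adj-outside (λ { refl → proj₂ xu xy })
            λ y∈N → y∉F (∈-⊝⁺ (x ∷ []) y∈N λ { (here y≡x) → irrefl G (sym y≡x) xy })
          x∉f : ∀ {f es} → f ∈ es → x ∉ ends es → x ∉ ends (f ∷ [])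
          x∉f f∈ x∉ (here refl)         = x∉ (∈-ends₁ f∈)
          x∉f f∈ x∉ (there (here refl)) = x∉ (∈-ends₂ f∈)
          dominated : ∀ {f} → f ∈ es → Dominates f x
          dominated {f} f∈ with adj? G (proj₁ f) x ⊎-dec adj? G (proj₂ f) x
          ... | yes dom′ = dom′
          ... | no ¬dom′ =
            let p , q , p∈ , q∈ , pq = All.lookup rift f∈
            in ⊥-elim (no-triple (undominated ¬dom x∉e p∈) (undominated ¬dom′ (x∉f f∈ (x∉ ∘ there ∘ there)) q∈) pq)

        -- Counting non-neighbours and the sets A and B.

        module _ {S₁ S₂ : List (Fin n)} (c : Config S₁ S₂) where
          open Config c

          -- S₂ uses up part of the degree of x in H. Partners lie outside S₂ anyway, so only the
          -- remaining non-neighbours have to be avoided.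
          nonNbrs-across : ∀ {x} → x ∈ S₁ → length S₂ + length (nonNbrs x ⊝ S₂) ≤ 2 + k
          nonNbrs-across {x} x∈ = ≤-trans (≤-reflexive (sym (length-++ S₂)))
            (≤-trans (unique-⊆-length
              (Unique.++⁺ unique₂ (⊝-unique S₂ (nonNbrs-unique x))
                (λ (y∈S₂ , y∈) → proj₂ (∈-⊝⁻ {U = nonNbrs x} S₂ y∈) y∈S₂))
              (λ y∈ → [ (λ y∈S₂ → ∈-nonNbrs⁺ (anti x∈ y∈S₂))
                      , (λ y∈N → proj₁ (∈-⊝⁻ {U = nonNbrs x} S₂ y∈N)) ]′ (∈-++⁻ S₂ y∈)))
              (nonNbrs≤ x))

          -- An outside vertex that misses x in S₁ and z in S₂ would form an independent triple with
          -- them. So A and B cover the (11 + 4k) - k outside vertices.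
          covering : 11 + 3 * k ≤ length (full S₁ S₂) + length (full S₂ S₁)
          covering = linear 0 (≤-trans all≥ (≤-trans (unique-⊆-length (Unique.allFin⁺ n) sub)
                       (≤-reflexive lengths))) (identity k (length (full S₁ S₂)) (length (full S₂ S₁)))
            where
            identity : ∀ k A B → 11 + 3 * k + (k + (A + B)) + 0 ≡ A + B + (11 + 4 * k)
            identity = solve-∀
            lengths : length ((S₁ ++ S₂) ++ (full S₁ S₂ ++ full S₂ S₁)) ≡ k + (length (full S₁ S₂) + length (full S₂ S₁))
            lengths = trans (length-++ (S₁ ++ S₂)) (cong₂ _+_ (trans (length-++ S₁) size) (length-++ (full S₁ S₂)))
            sub : allFin n ⊆ (S₁ ++ S₂) ++ (full S₁ S₂ ++ full S₂ S₁)
            sub {y} _ with y ∈? (S₁ ++ S₂)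
            ... | yes y∈ = ∈-++⁺ˡ y∈
            ... | no  y∉ with All.all? (adj? G y) S₂
            ...   | yes y-S₂ = ∈-++⁺ʳ (S₁ ++ S₂) (∈-++⁺ˡ (∈-filter⁺ (isFull? S₁ S₂) (∈-allFin y)
                                 ((y∉ ∘ ∈-++⁺ˡ , y∉ ∘ ∈-++⁺ʳ S₁) , y-S₂)))
            ...   | no ¬y-S₂ = ∈-++⁺ʳ (S₁ ++ S₂) (∈-++⁺ʳ (full S₁ S₂) (∈-filter⁺ (isFull? S₂ S₁) (∈-allFin y)
                                 ((y∉ ∘ ∈-++⁺ʳ S₁ , y∉ ∘ ∈-++⁺ˡ) , All.tabulate y-S₁)))
              where
              y-S₁ : ∀ {x} → x ∈ S₁ → Adj G y x
              y-S₁ {x} x∈ with adj-or-nonAdj (≢-sym (∈∉⇒≢ x∈ (y∉ ∘ ∈-++⁺ˡ)))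
              ... | inj₁ yx = yx
              ... | inj₂ yx =
                let z , z∈ , ¬yz = find (All.¬All⇒Any¬ (adj? G y) S₂ ¬y-S₂)
                in ⊥-elim (no-triple yx (≢-sym (∈∉⇒≢ z∈ (y∉ ∘ ∈-++⁺ʳ S₁)) , ¬yz) (anti x∈ z∈))

        -- Completing three edges to a connected matching of size t.

        module _ {S₁ S₂ : List (Fin n)} (c : Config S₁ S₂) where
          open Config c

          private
            a = length S₁
            b = length S₂

          -- The k edges at S₁ and S₂ and the three given ones make t. For a vertex of S₁ at most 5
          -- + a vertices are used, 2 + a non-neighbours lie outside S₂, and f more are forbidden;
          -- the bound on B exceeds the total by one.
          extend-three-edges : (e₁ e₂ e₃ : Edge) (f : ℕ) → let es = e₁ ∷ e₂ ∷ e₃ ∷ [] in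
            ConnectedMatching es → (∀ {y} → y ∈ ends es → y ∉ S₁ × y ∉ S₂) →
            (∀ {x} → x ∈ S₁ → ∃ λ F → length F ≤ f ×
              (∀ {y e} → e ∈ es → Adj G x y → y ∉ F → Joined G e (x , y))) →
            (∀ {x e} → x ∈ S₂ → e ∈ es → Dominates e x) →
            8 + 2 * a + f ≤ length (full S₁ S₂) → ⊥
          extend-three-edges e₁ e₂ e₃ f matching es-outside forb dom B≥ =
            let L , L-matching , L≡ = cliques-matching S₁ S₂ es unique₁ unique₂ clique₁ clique₂
                  (λ x∈ x∈′ → proj₁ (anti x∈ x∈′) refl) matching es-outside avail₁ avail₂
            in <⇒≢ (small L-matching) (trans L≡ (trans (cong (3 +_) size) (sym t≡)))
            where
            es = e₁ ∷ e₂ ∷ e₃ ∷ []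
            B = full S₁ S₂

            rest : List (Fin n)
            rest = allFin n ⊝ (S₁ ++ S₂)

            avail₁ : ∀ {x} → x ∈ S₁ → Available (Partner₁ S₁ S₂ es) (6 + a) x
            avail₁ {x} x∈ E E< with forb x∈
            ... | F , F≤f , joined =
              let y , y∈B , y∉ = unique-∉ {E = E ++ (N ++ F)} (full-unique S₁ S₂) room
                  (y∉S₁ , y∉S₂) , y-S₂ = ∈-full⁻ y∈B
                  xy = adj-outside (∈∉⇒≢ x∈ y∉S₁) λ y∈N →
                         y∉ (∈-++⁺ʳ E (∈-++⁺ˡ (∈-⊝⁺ S₂ y∈N y∉S₂)))
              in y , ((xy , (y∉S₁ , y∉S₂) , λ e∈ → joined e∈ xy (y∉ ∘ ∈-++⁺ʳ E ∘ ∈-++⁺ʳ N))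
                     , All.lookup y-S₂) , y∉ ∘ ∈-++⁺ˡ
              where
              N = nonNbrs x ⊝ S₂
              identity : ∀ e m F a b f B →
                suc (e + (m + F)) + (6 + a + (2 + (a + b)) + f + B) + 0 ≡ B + (suc e + (b + m) + F + (8 + 2 * a + f))
              identity = solve-∀
              room : length (E ++ (N ++ F)) < length B
              room = subst (_< length B) (sym (trans (length-++ E) (cong (length E +_) (length-++ N))))
                (linear 0 (+-mono-≤ (+-mono-≤ (+-mono-≤ E<
                    (subst (λ k → b + length N ≤ 2 + k) (sym size) (nonNbrs-across c x∈))) F≤f) B≥)
                  (identity (length E) (length N) (length F) a b f (length B)))

            -- The three edges dominate S₂, so any neighbour outside S₁ and S₂ can serve; at least
            -- 11 + 3k vertices lie there.
            avail₂ : ∀ {x} → x ∈ S₂ → Available (Partner S₁ S₂ es) (6 + (a + b)) x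
            avail₂ {x} x∈ E E< =
              let y , y∈R , y∉ = unique-∉ {E = E ++ N} (⊝-unique (S₁ ++ S₂) (Unique.allFin⁺ n)) room
                  y∉S  = proj₂ (∈-⊝⁻ {U = allFin n} (S₁ ++ S₂) y∈R)
                  y∉S₁ = y∉S ∘ ∈-++⁺ˡ
                  y∉S₂ = y∉S ∘ ∈-++⁺ʳ S₁
                  xy   = adj-outside (∈∉⇒≢ x∈ y∉S₂) λ y∈N → y∉ (∈-++⁺ʳ E (∈-⊝⁺ S₁ y∈N y∉S₁))
              in y , (xy , (y∉S₁ , y∉S₂) , λ e∈ → dominates⇒joined (dom x∈ e∈)) , y∉ ∘ ∈-++⁺ˡ
              where
              N = nonNbrs x ⊝ S₁
              identity : ∀ e m a b r →
                suc (e + m) + (6 + (a + b) + (2 + (a + b)) + (a + b + r)) + (3 + (a + a + b)) ≡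
                r + (suc e + (a + m) + (11 + 4 * (a + b)))
              identity = solve-∀
              rest≥ : 11 + 4 * (a + b) ≤ a + b + length rest
              rest≥ = subst (λ m → 11 + 4 * m ≤ a + b + length rest) (sym size) (≤-trans all≥
                (subst (λ m → length (allFin n) ≤ m + length rest) (length-++ S₁) (length-⊝ (S₁ ++ S₂) (Unique.allFin⁺ n))))
              room : length (E ++ N) < length rest
              room = subst (_< length rest) (sym (length-++ E))
                (linear (3 + (a + a + b)) (+-mono-≤ (+-mono-≤ E<
                    (subst (λ k → a + length N ≤ 2 + k) (sym size) (nonNbrs-across (swap c) x∈))) rest≥)
                  (identity (length E) (length N) a b (length rest)))

          -- The edges bv, cy, wz are pairwise joined, and pairwise separated by
          -- the non-edges bc, vw, yz.
          few-full : 9 + 3 * k ≤ length (full S₁ S₂) → ⊥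
          few-full B≥ =
            let b₀ , c₀ , b∈ , c∈ , bc = far-pair B! (≤-trans (≤-trans (m≤m+n (3 + k) (6 + 2 * k)) (≤-reflexive (id₁ k))) B≥)
                -- This list contains b and c too, each being a non-neighbour of the other; so v and
                -- w are new and adjacent to both.
                X₁ = nonNbrs b₀ ++ nonNbrs c₀
                v , w , v∈ , w∈ , vw = far-pair (⊝-unique X₁ B!) (room₁ b₀ c₀)
                v∈B , v∉ = ∈-⊝⁻ X₁ v∈
                w∈B , w∉ = ∈-⊝⁻ X₁ w∈
                -- b and v are already excluded as non-neighbours of c and w. But c and w are
                -- adjacent, so they have to be listed separately.
                X₂ = c₀ ∷ w ∷ nonNbrs c₀ ++ nonNbrs w
                y , z , y∈ , z∈ , yz = far-pair (⊝-unique X₂ B!) (room₂ c₀ w)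
                y∈B , y∉ = ∈-⊝⁻ X₂ y∈
                z∈B , z∉ = ∈-⊝⁻ X₂ z∈
                cb  = NonAdj-sym bc
                wv  = NonAdj-sym vw
                b≢v = ∈∉⇒≢ (∈-++⁺ʳ (nonNbrs b₀) (∈-nonNbrs⁺ cb)) v∉
                b≢w = ∈∉⇒≢ (∈-++⁺ʳ (nonNbrs b₀) (∈-nonNbrs⁺ cb)) w∉
                c≢v = ∈∉⇒≢ (∈-++⁺ˡ (∈-nonNbrs⁺ bc)) v∉
                c≢w = ∈∉⇒≢ (∈-++⁺ˡ (∈-nonNbrs⁺ bc)) w∉
                b∈X₂ = there (there (∈-++⁺ˡ (∈-nonNbrs⁺ cb)))
                v∈X₂ = there (there (∈-++⁺ʳ (nonNbrs c₀) (∈-nonNbrs⁺ wv)))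
                c∈X₂ = here refl
                w∈X₂ = there (here refl)
                es = (b₀ , v) ∷ (c₀ , y) ∷ (w , z) ∷ []
                edges : All (uncurry (Adj G)) es
                edges = adj-outside b≢v (v∉ ∘ ∈-++⁺ˡ)
                      ∷ adj-outside (∈∉⇒≢ c∈X₂ y∉) (y∉ ∘ there ∘ there ∘ ∈-++⁺ˡ)
                      ∷ adj-outside (∈∉⇒≢ w∈X₂ z∉) (z∉ ∘ there ∘ there ∘ ∈-++⁺ʳ (nonNbrs c₀)) ∷ []
                linked : AllPairs Linked es
                linked = ( ((proj₁ bc , ∈∉⇒≢ b∈X₂ y∉ , ≢-sym c≢v , ∈∉⇒≢ v∈X₂ y∉)
                             , inj₂ (inj₂ (inj₁ (symm G (adj-outside c≢v (v∉ ∘ ∈-++⁺ʳ (nonNbrs b₀)))))))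
                         ∷ ((b≢w , ∈∉⇒≢ b∈X₂ z∉ , proj₁ vw , ∈∉⇒≢ v∈X₂ z∉)
                             , inj₁ (adj-outside b≢w (w∉ ∘ ∈-++⁺ˡ)))
                         ∷ [])
                       ∷ ( ((c≢w , ∈∉⇒≢ c∈X₂ z∉ , ≢-sym (∈∉⇒≢ w∈X₂ y∉) , proj₁ yz)
                             , inj₁ (adj-outside c≢w (w∉ ∘ ∈-++⁺ʳ (nonNbrs b₀)))) ∷ [])
                       ∷ [] ∷ []
                rifts : AllPairs Rift es
                rifts = ( (b₀ , c₀ , here refl , here refl , bc)
                        ∷ (v , w , there (here refl) , here refl , vw) ∷ [])
                      ∷ ( (y , z , there (here refl) , there (here refl) , yz) ∷ [])
                      ∷ [] ∷ []
                ends∈B : All (_∈ B) (ends es)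
                ends∈B = b∈ ∷ v∈B ∷ c∈ ∷ y∈B ∷ w∈B ∷ z∈B ∷ []
                ends-full : ∀ {p} → p ∈ ends es → IsFull S₁ S₂ p
                ends-full p∈ = ∈-full⁻ (All.lookup ends∈B p∈)
            in extend-three-edges _ _ _ (1 + k) (edges , linked) (proj₁ ∘ ends-full)
                 (λ x∈ → forbidden es rifts (λ x∈es → proj₁ (proj₁ (ends-full x∈es)) x∈))
                 (λ x∈ e∈ → inj₁ (All.lookup (proj₂ (ends-full (∈-ends₁ e∈))) x∈))
                 -- Here a ≤ k is used; the bound is tight when S₂ is empty.
                 (≤-trans (subst (λ k → 8 + 2 * a + (1 + k) ≤ 9 + 3 * k) size
                   (≤-trans (m≤m+n _ (b + b)) (≤-reflexive (id₂ a b)))) B≥)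
            where
            B  = full S₁ S₂
            B! = full-unique S₁ S₂
            id₁ : ∀ k → 3 + k + (6 + 2 * k) ≡ 9 + 3 * k
            id₁ = solve-∀
            id₂ : ∀ a b → 8 + 2 * a + (1 + (a + b)) + (b + b) ≡ 9 + 3 * (a + b)
            id₂ = solve-∀
            room₁ : ∀ x y → 3 + k ≤ length (B ⊝ (nonNbrs x ++ nonNbrs y))
            room₁ x y = linear 2 (+-mono-≤ (+-mono-≤ (nonNbrs≤ x) (nonNbrs≤ y)) (≤-trans B≥ (length-⊝ X B!)))
              (trans (cong (λ m → 3 + k + (2 + k + (2 + k) + (m + r)) + 2) (length-++ (nonNbrs x)))
                     (identity k (length (nonNbrs x)) (length (nonNbrs y)) r))
              where
              X = nonNbrs x ++ nonNbrs y
              r = length (B ⊝ X)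
              identity : ∀ k p q r → 3 + k + (2 + k + (2 + k) + (p + q + r)) + 2 ≡ r + (p + q + (9 + 3 * k))
              identity = solve-∀
            -- Removing 2 + 2(2 + k) vertices from 9 + 3k leaves exactly the t = 3 + k that force a
            -- non-adjacent pair.
            room₂ : ∀ x y → 3 + k ≤ length (B ⊝ (x ∷ y ∷ nonNbrs x ++ nonNbrs y))
            room₂ x y = linear 0 (+-mono-≤ (+-mono-≤ (nonNbrs≤ x) (nonNbrs≤ y)) (≤-trans B≥ (length-⊝ X B!)))
              (trans (cong (λ m → 3 + k + (2 + k + (2 + k) + (2 + m + r)) + 0) (length-++ (nonNbrs x)))
                     (identity k (length (nonNbrs x)) (length (nonNbrs y)) r))
              where
              X = x ∷ y ∷ nonNbrs x ++ nonNbrs y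
              r = length (B ⊝ X)
              identity : ∀ k p q r → 3 + k + (2 + k + (2 + k) + (2 + (p + q) + r)) + 0 ≡ r + (p + q + (9 + 3 * k))
              identity = solve-∀

        dominating-extends : ∀ {S₁ S₂} → Config S₁ S₂ → (e₁ e₂ e₃ : Edge) → let es = e₁ ∷ e₂ ∷ e₃ ∷ [] in
          ConnectedMatching es → (∀ {y} → y ∈ ends es → y ∉ S₁ × y ∉ S₂) →
          (∀ {x e} → x ∈ S₁ → e ∈ es → Dominates e x) →
          (∀ {x e} → x ∈ S₂ → e ∈ es → Dominates e x) →
          8 + 2 * length S₁ ≤ length (full S₁ S₂) → ⊥
        dominating-extends c e₁ e₂ e₃ matching es-outside dom₁ dom₂ B≥ =
          extend-three-edges c e₁ e₂ e₃ 0 matching es-outside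
            (λ x∈ → [] , z≤n , λ e∈ _ _ → dominates⇒joined (dom₁ x∈ e∈)) dom₂
            (≤-trans (≤-reflexive (+-identityʳ _)) B≥)

        -- Three edges between A and B.

        module _ (4≤k : 4 ≤ k) {S₁ S₂ : List (Fin n)} (c : Config S₁ S₂) where
          open Config c

          private
            A = full S₂ S₁
            B = full S₁ S₂
            A! = full-unique S₂ S₁
            B! = full-unique S₁ S₂

          -- An edge uv with u ∈ A and v ∈ B dominates both S₁ and S₂.
          no-crossing-edges : (e₁ e₂ e₃ : Edge) → let es = e₁ ∷ e₂ ∷ e₃ ∷ [] in
            ConnectedMatching es → All (λ e → proj₁ e ∈ A × proj₂ e ∈ B) es → ⊥
          no-crossing-edges e₁ e₂ e₃ matching crossing@((u₁∈ , v₁∈) ∷ (u₂∈ , v₂∈) ∷ (u₃∈ , v₃∈) ∷ []) =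
            [ dominating-extends c e₁ e₂ e₃ matching es-outside dom₁ dom₂
            , dominating-extends (swap c) e₁ e₂ e₃ matching
                (λ y∈ → proj₂ (es-outside y∈) , proj₁ (es-outside y∈)) dom₂ dom₁
            ]′ room
            where
            es = e₁ ∷ e₂ ∷ e₃ ∷ []
            A-outside : ∀ {y} → y ∈ A → y ∉ S₁ × y ∉ S₂
            A-outside y∈ = let (y∉S₂ , y∉S₁) , _ = ∈-full⁻ y∈ in y∉S₁ , y∉S₂
            B-outside : ∀ {y} → y ∈ B → y ∉ S₁ × y ∉ S₂
            B-outside y∈ = proj₁ (∈-full⁻ y∈)
            es-outside : ∀ {y} → y ∈ ends es → y ∉ S₁ × y ∉ S₂
            es-outside = All.lookup (A-outside u₁∈ ∷ B-outside v₁∈ ∷ A-outside u₂∈ ∷ B-outside v₂∈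
                                    ∷ A-outside u₃∈ ∷ B-outside v₃∈ ∷ [])
            dom₁ : ∀ {x e} → x ∈ S₁ → e ∈ es → Dominates e x
            dom₁ x∈ e∈ = inj₁ (All.lookup (proj₂ (∈-full⁻ (proj₁ (All.lookup crossing e∈)))) x∈)
            dom₂ : ∀ {x e} → x ∈ S₂ → e ∈ es → Dominates e x
            dom₂ x∈ e∈ = inj₂ (All.lookup (proj₂ (∈-full⁻ (proj₂ (All.lookup crossing e∈)))) x∈)
            -- If both failed, A and B would have at most 14 + 2k vertices together, fewer than 11 +
            -- 3k as k ≥ 4. Since crossing edges dominate both cliques, either clique may take the
            -- role of S₁.
            room : 8 + 2 * length S₁ ≤ length B ⊎ 8 + 2 * length S₂ ≤ length A
            room with 8 + 2 * length S₁ ≤? length B | 8 + 2 * length S₂ ≤? length A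
            ... | yes B≥ | _      = inj₁ B≥
            ... | no  _  | yes A≥ = inj₂ A≥
            ... | no  B≱ | no  A≱ = contradiction
              (too-small (length S₁) (length S₂) k size 4≤k (covering c) (≰⇒> B≱) (≰⇒> A≱)) λ ()
              where
              too-small : ∀ a b k {A B} → a + b ≡ k → 4 ≤ k → 11 + 3 * k ≤ B + A →
                          suc B ≤ 8 + 2 * a → suc A ≤ 8 + 2 * b → 1 ≤ 0
              too-small a b _ {A} {B} refl 4≤k B+A≥ B< A< =
                linear 0 (+-mono-≤ (+-mono-≤ 4≤k B+A≥) (+-mono-≤ B< A<)) (identity a b A B)
                where
                identity : ∀ a b A B → 1 + (a + b + (B + A) + (8 + 2 * a + (8 + 2 * b))) + 0 ≡
                                        0 + (4 + (11 + 3 * (a + b)) + (suc B + suc A))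
                identity = solve-∀

          module _ {p₁ p₂ p₃} (p₁∈ : p₁ ∈ A) (p₂∈ : p₂ ∈ A) (p₃∈ : p₃ ∈ A)
                   (p₁≢p₂ : p₁ ≢ p₂) (p₁≢p₃ : p₁ ≢ p₃) (p₂≢p₃ : p₂ ≢ p₃) where

            ps : List (Fin n)
            ps = p₁ ∷ p₂ ∷ p₃ ∷ []

            in₁ : p₁ ∈ ps
            in₁ = here refl
            in₂ : p₂ ∈ ps
            in₂ = there (here refl)
            in₃ : p₃ ∈ ps
            in₃ = there (there (here refl))

            -- The edges pᵢvᵢ are joined through the triangle, so vᵢ need only be adjacent to pᵢ. It
            -- avoids at most 2 + k non-neighbours, the three pⱼ and two earlier choices.
            triangle-impossible : Adj G p₁ p₂ → Adj G p₁ p₃ → Adj G p₂ p₃ → 8 + k ≤ length B → ⊥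
            triangle-impossible p₁p₂ p₁p₃ p₂p₃ B≥ =
              no-partners (three-partners ps (nonNbrs p₁) (nonNbrs p₂) (nonNbrs p₃) B! (room p₁) (room p₂) (room p₃))
              where
              room : ∀ p → 3 + (3 + length (nonNbrs p)) ≤ length B
              room p = ≤-trans (+-monoʳ-≤ 6 (nonNbrs≤ p)) B≥
              no-partners : Partners B ps (nonNbrs p₁) (nonNbrs p₂) (nonNbrs p₃) → ⊥
              no-partners (v₁ , v₂ , v₃ , (v₁∈ , v₂∈ , v₃∈) , (v₁∉ , v₂∉ , v₃∉) , (q₁ , q₂ , q₃) , v₁≢v₂ , v₁≢v₃ , v₂≢v₃) =
                no-crossing-edges (p₁ , v₁) (p₂ , v₂) (p₃ , v₃)
                  ( ( adj-outside (∈∉⇒≢ in₁ q₁) v₁∉ ∷ adj-outside (∈∉⇒≢ in₂ q₂) v₂∉ ∷ adj-outside (∈∉⇒≢ in₃ q₃) v₃∉ ∷ [])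
                  , ( (((p₁≢p₂ , ∈∉⇒≢ in₁ q₂ , ≢-sym (∈∉⇒≢ in₂ q₁) , v₁≢v₂) , inj₁ p₁p₂)
                       ∷ ((p₁≢p₃ , ∈∉⇒≢ in₁ q₃ , ≢-sym (∈∉⇒≢ in₃ q₁) , v₁≢v₃) , inj₁ p₁p₃) ∷ [])
                    ∷ (((p₂≢p₃ , ∈∉⇒≢ in₂ q₃ , ≢-sym (∈∉⇒≢ in₃ q₂) , v₂≢v₃) , inj₁ p₂p₃) ∷ [])
                    ∷ [] ∷ []))
                  ((p₁∈ , v₁∈) ∷ (p₂∈ , v₂∈) ∷ (p₃∈ , v₃∈) ∷ [])

            -- Each vᵢ is a common neighbour of two of the pⱼ, so that the
            -- edges pᵢvᵢ are joined cyclically.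
            large-B-impossible : 10 + 2 * k ≤ length B → ⊥
            large-B-impossible B≥ = no-partners
              (three-partners ps (nonNbrs p₁ ++ nonNbrs p₂) (nonNbrs p₂ ++ nonNbrs p₃) (nonNbrs p₃ ++ nonNbrs p₁)
                     B! (room p₁ p₂) (room p₂ p₃) (room p₃ p₁))
              where
              identity : ∀ k → 6 + (2 + k + (2 + k)) ≡ 10 + 2 * k
              identity = solve-∀
              room : ∀ p q → 3 + (3 + length (nonNbrs p ++ nonNbrs q)) ≤ length B
              room p q = ≤-trans (+-monoʳ-≤ 6 (≤-trans (≤-reflexive (length-++ (nonNbrs p)))
                           (+-mono-≤ (nonNbrs≤ p) (nonNbrs≤ q)))) (≤-trans (≤-reflexive (identity k)) B≥)
              no-partners : Partners B ps (nonNbrs p₁ ++ nonNbrs p₂) (nonNbrs p₂ ++ nonNbrs p₃) (nonNbrs p₃ ++ nonNbrs p₁) → ⊥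
              no-partners (v₁ , v₂ , v₃ , (v₁∈ , v₂∈ , v₃∈) , (v₁∉ , v₂∉ , v₃∉) , (q₁ , q₂ , q₃) , v₁≢v₂ , v₁≢v₃ , v₂≢v₃) =
                let p₁≢v₁ = ∈∉⇒≢ in₁ q₁
                    p₁≢v₃ = ∈∉⇒≢ in₁ q₃
                    p₂≢v₁ = ∈∉⇒≢ in₂ q₁
                    p₂≢v₂ = ∈∉⇒≢ in₂ q₂
                    p₃≢v₂ = ∈∉⇒≢ in₃ q₂
                    p₃≢v₃ = ∈∉⇒≢ in₃ q₃
                in no-crossing-edges (p₁ , v₁) (p₂ , v₂) (p₃ , v₃)
                  ( ( adj-outside p₁≢v₁ (v₁∉ ∘ ∈-++⁺ˡ) ∷ adj-outside p₂≢v₂ (v₂∉ ∘ ∈-++⁺ˡ) ∷ adj-outside p₃≢v₃ (v₃∉ ∘ ∈-++⁺ˡ) ∷ [])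
                  , ( (((p₁≢p₂ , ∈∉⇒≢ in₁ q₂ , ≢-sym p₂≢v₁ , v₁≢v₂)
                         , inj₂ (inj₂ (inj₁ (symm G (adj-outside p₂≢v₁ (v₁∉ ∘ ∈-++⁺ʳ (nonNbrs p₁)))))))
                       ∷ ((p₁≢p₃ , p₁≢v₃ , ≢-sym (∈∉⇒≢ in₃ q₁) , v₁≢v₃)
                         , inj₂ (inj₁ (adj-outside p₁≢v₃ (v₃∉ ∘ ∈-++⁺ʳ (nonNbrs p₃))))) ∷ [])
                    ∷ (((p₂≢p₃ , ∈∉⇒≢ in₂ q₃ , ≢-sym p₃≢v₂ , v₂≢v₃)
                         , inj₂ (inj₂ (inj₁ (symm G (adj-outside p₃≢v₂ (v₂∉ ∘ ∈-++⁺ʳ (nonNbrs p₂))))))) ∷ [])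
                    ∷ [] ∷ []))
                  ((p₁∈ , v₁∈) ∷ (p₂∈ , v₂∈) ∷ (p₃∈ , v₃∈) ∷ [])

          -- If A has at most 2 vertices, `covering` leaves 9 + 3k for B. Otherwise, if B has at
          -- least 10 + 2k vertices, any three vertices of A will do. If not, A has at least 2 + k ≥
          -- 6 vertices and contains a triangle of G by R(3, 3) ≤ 6, while B, the larger of two sets
          -- with sizes summing to at least 11 + 3k, has at least 8 + k since k ≥ 4.
          no-config-≤ : length A ≤ length B → ⊥
          no-config-≤ A≤B with length A ≤? 2
          ... | yes A≤2 = few-full c (9+3k≤B (+-mono-≤ (covering c) A≤2))
            where
            identity : ∀ k A B → 9 + 3 * k + (B + A + 2) + 0 ≡ B + (11 + 3 * k + A)
            identity = solve-∀
            9+3k≤B : 11 + 3 * k + length A ≤ length B + length A + 2 → 9 + 3 * k ≤ length B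
            9+3k≤B p = linear 0 p (identity k (length A) (length B))
          ... | no A≰2 with 10 + 2 * k ≤? length B
          ...   | yes B≥ =
            let p₁ , p₂ , p₃ , (p₁∈ , p₂∈ , p₃∈) , p₁≢p₂ , p₁≢p₃ , p₂≢p₃ = three-elements A! (≰⇒> A≰2)
            in large-B-impossible p₁∈ p₂∈ p₃∈ p₁≢p₂ p₁≢p₃ p₂≢p₃ B≥
          ...   | no B≱ =
            let C , C! , cl , C⊆A , 3≤C = ramsey 3 A! 6≤A
                p₁ , p₂ , p₃ , (p₁∈ , p₂∈ , p₃∈) , p₁≢p₂ , p₁≢p₃ , p₂≢p₃ = three-elements C! 3≤C
            in triangle-impossible (C⊆A p₁∈) (C⊆A p₂∈) (C⊆A p₃∈) p₁≢p₂ p₁≢p₃ p₂≢p₃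
                 (cl p₁∈ p₂∈ p₁≢p₂) (cl p₁∈ p₃∈ p₁≢p₃) (cl p₂∈ p₃∈ p₂≢p₃) 8+k≤B
            where
            identity₁ : ∀ k A B → 6 + (B + A + (10 + 2 * k) + k) + 0 ≡ A + (11 + 3 * k + suc B + 4)
            identity₁ = solve-∀
            6≤A : 6 ≤ length A
            6≤A = linear 0 (+-mono-≤ (+-mono-≤ (covering c) (≰⇒> B≱)) 4≤k) (identity₁ k (length A) (length B))
            8+k≤B : 8 + k ≤ length B
            8+k≤B with 8 + k ≤? length B
            ... | yes p = p
            ... | no ¬p = contradiction
              (linear {l = 1} {r = 0} 0
                (+-mono-≤ (+-mono-≤ (+-mono-≤ (covering c) A≤B) 4≤k) (+-mono-≤ (≰⇒> ¬p) (≰⇒> ¬p)))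
                (identity₂ k (length A) (length B))) λ ()
              where
              identity₂ : ∀ k A B → 1 + (B + A + B + k + (8 + k + (8 + k))) + 0 ≡
                                    0 + (11 + 3 * k + A + 4 + (suc B + suc B))
              identity₂ = solve-∀

        -- Symmetry, and reduction to total size exactly t - 3.

        no-config : 4 ≤ k → ∀ {S₁ S₂} → Config S₁ S₂ → ⊥
        no-config 4≤k {S₁} {S₂} c with ≤-total (length (full S₂ S₁)) (length (full S₁ S₂))
        ... | inj₁ A≤B = no-config-≤ 4≤k c A≤B
        ... | inj₂ B≤A = no-config-≤ 4≤k (swap c) B≤A

        -- Anti-complete cliques stay so when shrunk: S₁ is cut to at most k vertices and S₂ fills
        -- up to exactly k, contributing none if S₁ alone suffices.
        cliques-bound : 4 ≤ k → ∀ {S₁ S₂} → Unique S₁ → Unique S₂ → Clique S₁ → Clique S₂ →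
          (∀ {x y} → x ∈ S₁ → y ∈ S₂ → NonAdj x y) → length S₁ + length S₂ < k
        cliques-bound 4≤k {S₁} {S₂} S₁! S₂! cl₁ cl₂ anti = ≰⇒> λ k≤ → no-config 4≤k record
          { unique₁ = Unique.take⁺ k S₁!
          ; unique₂ = Unique.take⁺ (k ∸ length S₁) S₂!
          ; clique₁ = λ x∈ y∈ → cl₁ (∈-take⁻ k x∈) (∈-take⁻ k y∈)
          ; clique₂ = λ x∈ y∈ → cl₂ (∈-take⁻ (k ∸ length S₁) x∈) (∈-take⁻ (k ∸ length S₁) y∈)
          ; anti    = λ x∈ y∈ → anti (∈-take⁻ k x∈) (∈-take⁻ (k ∸ length S₁) y∈)
          ; size    = trans (cong₂ _+_ (length-take k S₁) (length-take-≤ {m = k ∸ length S₁} {xs = S₂} (m≤n+o⇒m∸n≤o k (length S₁) k≤)))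
                            (trans (cong (_+ (k ∸ length S₁)) (⊓-comm k (length S₁))) (m⊓n+n∸m≡n (length S₁) k))
          }

theorem1p4 : (t : ℕ) → 1 ≤ t →
    (G : Graph (4 * t ∸ 1)) → MinimalCounterexample t G →
    (S₁ S₂ : Subset (4 * t ∸ 1)) → Disjoint S₁ S₂ →
    IsClique G S₁ → IsClique G S₂ → AntiComplete G S₁ S₂ →
    (∣ S₁ ∣ + ∣ S₂ ∣) + 4 ≤ t
theorem1p4 t@(suc t-1) 1≤t G min S₁ S₂ disjoint cl₁ cl₂ anti =
  subst₂ (λ s m → s + 4 ≤ m) (cong₂ _+_ (length-elements S₁) (length-elements S₂)) 3+k≡t
    (≤-trans (≤-reflexive (+-comm _ 4)) (+-monoʳ-≤ 3 bound))
  where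
  open MinimalCounterexample min
  k = t ∸ 3
  no-triple : ∀ {x y z} → NonAdj G x y → NonAdj G x z → NonAdj G y z → ⊥
  no-triple = α≤2⇒no-independent-triple G (≤-reflexive α≡2)
  small : ∀ {L} → ConnectedMatching G L → length L < t
  small matching = s≤s (≤-trans (length≤cm G matching) cm≤t-1)
  n≡ : suc (4 * t ∸ 1) ≡ 4 * t
  n≡ = refl
  7≤t : 7 ≤ t
  7≤t = t≥7 G no-triple t n≡ small 1≤t
  3+k≡t : 3 + k ≡ t
  3+k≡t = m+[n∸m]≡n (≤-trans (s≤s (s≤s (s≤s z≤n))) 7≤t)
  -- Strictness supplies the last unit: less than t - 3 means at most t - 4.
  bound : length (elements S₁) + length (elements S₂) < k
  bound = cliques-bound G no-triple t n≡ small k (sym 3+k≡t) (∸-monoˡ-≤ 3 7≤t)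
    (elements-unique S₁) (elements-unique S₂)
    (λ x∈ y∈ → cl₁ _ _ (∈-elements⁻ S₁ x∈) (∈-elements⁻ S₁ y∈))
    (λ x∈ y∈ → cl₂ _ _ (∈-elements⁻ S₂ x∈) (∈-elements⁻ S₂ y∈))
    (λ x∈ y∈ → let x∈S₁ = ∈-elements⁻ S₁ x∈ ; y∈S₂ = ∈-elements⁻ S₂ y∈ in
      (λ { refl → disjoint _ x∈S₁ y∈S₂ }) , anti _ _ x∈S₁ y∈S₂)
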